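{- Let $G$ be a connected graph with $k$ pendant edges. If $l$ ($l\leq k$) pendant edges are removed from $G$ (keeping all vertices), yielding the graph $G'$, then $$meg(G)-l\leq meg(G')\leq meg(G).$$ Moreover, both the lower and the upper bounds are tight (i.e. for each of the two inequalities there are graphs $G$ and choices of removed pendant edges for which equality holds).
   Context: Graphs are finite, undirected and simple. A cut edge is an edge whose removal increases the number of connected components; a pendant edge is a cut edge with one of its end vertices of degree one. In a connected graph $H$, an edge $e$ is monitored by a pair of vertices $x,y$ if $e$ lies on all shortest paths between $x$ and $y$. A set $M\subseteq V(H)$ is a monitoring edge-geodetic set (MEG-set) of $H$ if every edge of $H$ is monitored by some pair of vertices of $M$; $meg(H)$ is the minimum size of a MEG-set of $H$. For a disconnected graph, a MEG-set is the union of MEG-sets of its connected components, where the MEG-set of an isolated vertex is taken to be empty; so $meg$ is the sum of the $meg$ of the components, an isolated vertex contributing $0$.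
   Formalization: A pendant edge must have exactly one end vertex of degree one, so the edge of K2 does not count as pendant; with it the lower bound fails, since meg(K2)=2 but removing its edge leaves two isolated vertices with meg 0 < 2-1. -}

module Defs where

open import Data.Fin using (Fin)
open import Data.Fin.Properties using (_≟_)
open import Data.Fin.Subset using (Subset; _∈_; _∉_; ∣_∣; Nonempty)
open import Data.List using (List; []; _∷_; length; [_])
open import Data.List.Relation.Unary.All using (All)
open import Data.List.Relation.Unary.Any using (Any; any?; map)
open import Data.List.Relation.Unary.AllPairs using (AllPairs)
open import Data.List.Relation.Unary.Unique.Propositional using (Unique)
open import Data.Nat using (ℕ; suc; _≤_; _<_)
open import Data.Product using (Σ; ∃; ∃₂; _×_; _,_; proj₁)
open import Data.Sum using (_⊎_; inj₁; inj₂)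
open import Data.Empty using (⊥)
open import Data.Vec using (tabulate)
open import Function using (_∘_; Surjective)
open import Function.Bundles using (_⇔_)
open import Level using (0ℓ)
open import Relation.Binary using (Rel; Decidable; Symmetric)
open import Relation.Binary.Construct.Closure.ReflexiveTransitive using (Star; ε; _◅_)
open import Relation.Binary.PropositionalEquality using (_≡_; _≢_)
open import Relation.Nullary using (¬_; does)
open import Relation.Nullary.Decidable using (_×-dec_; _⊎-dec_; ¬?)
open import Relation.Unary using (Pred)

record Graph (V : Set) : Set₁ where
  field
    Adj     : Rel V 0ℓ
    adj?    : Decidable Adj
    adj-sym : Symmetric Adj
    irrefl  : ∀ {v} → ¬ Adj v v

open Graph public

-- An undirected edge is given by a pair of end vertices, in either order.
SameEdge : {V : Set} → Rel (V × V) 0ℓ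
SameEdge (u , v) (x , y) = (u ≡ x × v ≡ y) ⊎ (u ≡ y × v ≡ x)

Distinct : {V : Set} → List (V × V) → Set
Distinct = AllPairs (λ e f → ¬ SameEdge e f)

Walk : {V : Set} → Graph V → Rel V 0ℓ
Walk H = Star (Adj H)

-- A single vertex is connected; the empty graph is not.
Connected : {V : Set} → Graph V → Set
Connected {V} H = V × (∀ x y → Walk H x y)

module _ {V : Set} {H : Graph V} where

  len : ∀ {x y} → Walk H x y → ℕ
  len ε       = 0
  len (_ ◅ p) = suc (len p)

  vertices : ∀ {x y} → Walk H x y → List V
  vertices {x} ε       = [ x ]
  vertices {x} (_ ◅ p) = x ∷ vertices p

  IsPath : ∀ {x y} → Walk H x y → Set
  IsPath p = Unique (vertices p)

  IsShortestPath : ∀ {x y} → Walk H x y → Set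
  IsShortestPath {x} {y} p =
    IsPath p × (∀ (q : Walk H x y) → IsPath q → len p ≤ len q)

  LiesOn : V × V → ∀ {x y} → Walk H x y → Set
  LiesOn e ε                   = ⊥
  LiesOn e (_◅_ {i} {j} _ p) = SameEdge e (i , j) ⊎ LiesOn e p

-- Only meant for connected H: for x and y in different components the
-- condition would be vacuous.
Monitors : {V : Set} → Graph V → V → V → V × V → Set
Monitors H x y e = ∀ (p : Walk H x y) → IsShortestPath {H = H} p → LiesOn {H = H} e p

-- MEG-sets of a connected graph.
IsMEGSetᶜ : {V : Set} → Graph V → Pred V 0ℓ → Set
IsMEGSetᶜ H M =
  ∀ u v → Adj H u v → ∃₂ λ x y → M x × M y × Monitors H x y (u , v)

module _ {n : ℕ} where

  IsComponent : Graph (Fin n) → Subset n → Set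
  IsComponent G C =
    Nonempty C × (∀ x → x ∈ C → ∀ y → (y ∈ C ⇔ Walk G x y))

  infix 9 _⟨_⟩
  _⟨_⟩ : Graph (Fin n) → (C : Subset n) → Graph (∃ (_∈ C))
  G ⟨ C ⟩ = record
    { Adj     = λ u v → Adj G (proj₁ u) (proj₁ v)
    ; adj?    = λ u v → adj? G (proj₁ u) (proj₁ v)
    ; adj-sym = adj-sym G
    ; irrefl  = irrefl G
    }

  -- M is the union of the sets M ∩ C over the components C, so it is a union
  -- of MEG-sets of the components exactly when every M ∩ C is a MEG-set of
  -- G ⟨ C ⟩; the MEG-set of an isolated vertex is the empty set.
  IsMEGSet : Graph (Fin n) → Subset n → Set
  IsMEGSet G M =
    ∀ C → IsComponent G C →
      IsMEGSetᶜ (G ⟨ C ⟩) (λ x → proj₁ x ∈ M)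
      × (∣ C ∣ ≡ 1 → ∀ x → x ∈ C → x ∉ M)

  -- meg(G) = m, as a relation: m is the least size of a MEG-set of G.
  -- (The set of all non-isolated vertices is a MEG-set, so MEG-sets exist.)
  HasMeg : Graph (Fin n) → ℕ → Set
  HasMeg G m =
    (Σ (Subset n) λ M → IsMEGSet G M × ∣ M ∣ ≡ m)
    × (∀ M → IsMEGSet G M → m ≤ ∣ M ∣)

  sameEdge? : Decidable (SameEdge {Fin n})
  sameEdge? (u , v) (x , y) =
    (u ≟ x ×-dec v ≟ y) ⊎-dec (u ≟ y ×-dec v ≟ x)

  private
    flip-any : ∀ {u v : Fin n} {es} →
               Any (SameEdge (u , v)) es → Any (SameEdge (v , u)) es
    flip-any = map
      λ { (inj₁ (a , b)) → inj₂ (b , a) ; (inj₂ (a , b)) → inj₁ (b , a) }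

  infixl 6 _∖_
  _∖_ : Graph (Fin n) → List (Fin n × Fin n) → Graph (Fin n)
  G ∖ es = record
    { Adj     = λ u v → Adj G u v × ¬ Any (SameEdge (u , v)) es
    ; adj?    = λ u v → adj? G u v ×-dec ¬? (any? (sameEdge? (u , v)) es)
    ; adj-sym = λ (a , ∉es) → adj-sym G a , (∉es ∘ flip-any)
    ; irrefl  = irrefl G ∘ proj₁
    }

  -- A labelling of the components by Fin c.
  NumComponents : Graph (Fin n) → ℕ → Set
  NumComponents G c =
    Σ (Fin n → Fin c) λ f →
      Surjective _≡_ _≡_ f × (∀ x y → (f x ≡ f y ⇔ Walk G x y))

  CutEdge : Graph (Fin n) → Fin n × Fin n → Set
  CutEdge G e@(u , v) =
    Adj G u v ×
    ∃₂ λ c c′ → NumComponents G c × NumComponents (G ∖ [ e ]) c′ × c < c′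

  degree : Graph (Fin n) → Fin n → ℕ
  degree G v = ∣ tabulate (λ w → does (adj? G v w)) ∣

  -- Exactly one end has degree one.  In a connected graph this differs from
  -- "at least one" only for K₂, whose edge is not pendant here; with the other
  -- convention, removing that edge would take meg from 2 to 0.
  Pendant : Graph (Fin n) → Fin n × Fin n → Set
  Pendant G (u , v) =
    CutEdge G (u , v) ×
    ((degree G u ≡ 1 × degree G v ≢ 1) ⊎ (degree G u ≢ 1 × degree G v ≡ 1))

  NumPendant : Graph (Fin n) → ℕ → Set
  NumPendant G k =
    Σ (List (Fin n × Fin n)) λ ps →
      Distinct ps × All (Pendant G) ps
      × (∀ u v → Pendant G (u , v) → Any (SameEdge (u , v)) ps)
      × length ps ≡ k

  -- es lists l different pendant edges of the connected graph G, which has k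
  -- pendant edges in total.
  record PendantRemoval (G : Graph (Fin n)) (k l : ℕ)
                        (es : List (Fin n × Fin n)) : Set where
    field
      connected  : Connected G
      numPendant : NumPendant G k
      l≤k        : l ≤ k
      distinct   : Distinct es
      pendant    : All (Pendant G) es
      size       : length es ≡ l

{-# OPTIONS --safe #-}
module Submission where

-- Let L be the set of the removed leaves, each attached to its support.  Every
-- walk of G retracts onto a walk of G′ by collapsing each leaf onto its
-- support, and each end of the walk that is a leaf costs one edge.  So if M is
-- a MEG-set of G, then its image under the retraction, without isolated
-- vertices, is one of G′; and if M′ is a MEG-set of G′, then M′ ∪ L is one
-- of G: the edge of a leaf is monitored by the leaf together with any other
-- vertex of M′ ∪ L, and there is one because the support has another neighbour.
-- Both bounds are attained by the path on three vertices, on removing two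
-- edges and one edge respectively.

open import Defs
open import Data.Empty using (⊥-elim)
open import Data.Fin using (Fin; zero; suc)
open import Data.Fin.Patterns using (0F; 1F; 2F)
open import Data.Fin.Properties using (_≟_; any?)
open import Data.Fin.Subset
  using (Subset; inside; outside; _∈_; _∉_; ∣_∣; ⊤; ⊥; ⁅_⁆; ∁; _∪_; _∩_)
open import Data.Fin.Subset.Properties
open import Data.Integer using (+_; _⊖_) renaming (_≤_ to _≤ℤ_)
import Data.Integer.Properties as ℤ
open import Data.List using (List; []; _∷_; length)
open import Data.List.Relation.Unary.All as All using (All; []; _∷_)
open import Data.List.Relation.Unary.All.Properties using (¬Any⇒All¬)
open import Data.List.Relation.Unary.AllPairs using ([]; _∷_)
open import Data.List.Relation.Unary.Any as Any using (Any; here; there)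
import Data.List.Membership.Propositional as List
import Data.List.Membership.DecPropositional as DecMembership
open import Data.Nat using (ℕ; suc; z≤n; s≤s; _≤_; _<_; _+_)
open import Data.Nat.Properties hiding (_≟_)
open import Algebra.Properties.CommutativeSemigroup +-commutativeSemigroup
  using (interchange; x∙yz≈y∙xz)
open import Data.Product using (Σ; ∃; ∃₂; _×_; _,_; proj₁; proj₂; ∃-syntax)
open import Data.Sum using (_⊎_; inj₁; inj₂; [_,_]′) renaming (map to map-⊎)
open import Data.Vec using (tabulate; []; _∷_; here; there)
open import Data.Vec.Properties using ([]=⇒lookup; lookup⇒[]=; lookup∘tabulate)
open import Data.Vec.Properties.WithK using ([]=-irrelevant)
open import Function using (_∘_; id; mk⇔)
open import Function.Bundles using (_⇔_; Equivalence)
open import Level using (0ℓ)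
open import Relation.Binary using (DecidableEquality)
open import Relation.Binary.Construct.Closure.ReflexiveTransitive
  using (ε; _◅_; _◅◅_; reverse)
open import Relation.Binary.PropositionalEquality
  using (_≡_; _≢_; refl; sym; trans; cong; cong₂; subst)
open import Relation.Nullary using (yes; no; ¬_; does; contradiction)
open import Relation.Nullary.Decidable
  using (dec-true; decidable-stable; from-yes; ¬?; _×-dec_)
open import Relation.Unary using (Pred; Decidable)

private variable
  n   : ℕ
  V W : Set

-- Geodesics

Geodesic : (H : Graph V) → ∀ {x y} → Walk H x y → Set
Geodesic H {x} {y} p = ∀ (q : Walk H x y) → len {H = H} p ≤ len {H = H} q

-- Comparing with all walks instead of paths spares every proof that a walk
-- built by concatenation or retraction is a path.
MonitorsGeodesics : Graph V → V → V → V × V → Set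
MonitorsGeodesics H x y e =
  ∀ (p : Walk H x y) → Geodesic H p → LiesOn {H = H} e p

module _ (_≟ᵥ_ : DecidableEquality V) (H : Graph V) where

  open DecMembership _≟ᵥ_ using () renaming (_∈?_ to _∈ₗ?_)

  dropUntil : ∀ {w x y} (p : Walk H x y) → w List.∈ vertices {H = H} p →
              Σ (Walk H w y) λ q → len {H = H} q ≤ len {H = H} p
  dropUntil ε       (here refl) = ε , z≤n
  dropUntil (a ◅ p) (here refl) = a ◅ p , ≤-refl
  dropUntil (a ◅ p) (there w∈p) with dropUntil p w∈p
  ... | q , q≤p = q , m≤n⇒m≤1+n q≤p

  -- If the first vertex recurs, the walk from the recurrence on does without the first edge, so it
  -- is strictly shorter. `toPath` iterates this.
  path-or-shorter : ∀ {x y} (p : Walk H x y) →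
    IsPath {H = H} p ⊎ Σ (Walk H x y) λ q → len {H = H} q < len {H = H} p
  path-or-shorter ε = inj₁ ([] ∷ [])
  path-or-shorter {x} (a ◅ p) with path-or-shorter p
  ... | inj₂ (q , q<p) = inj₂ (a ◅ q , s≤s q<p)
  ... | inj₁ unique with x ∈ₗ? vertices {H = H} p
  ...   | no  x∉p = inj₁ (¬Any⇒All¬ _ x∉p ∷ unique)
  ...   | yes x∈p with dropUntil p x∈p
  ...     | q , q≤p = inj₂ (q , s≤s q≤p)

  toPath : ∀ {x y} (p : Walk H x y) →
    Σ (Walk H x y) λ q → IsPath {H = H} q × len {H = H} q ≤ len {H = H} p
  toPath p = go _ p ≤-refl
    where
    -- `k` bounds the length and serves as fuel: every shortcut lowers the length.
    go : ∀ k {x y} (p : Walk H x y) → len {H = H} p ≤ k →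
         Σ (Walk H x y) λ q → IsPath {H = H} q × len {H = H} q ≤ len {H = H} p
    go k p p≤k with path-or-shorter p
    ... | inj₁ path = p , path , ≤-refl
    go ℕ.zero p p≤k | inj₂ (q , q<p) = contradiction (≤-trans q<p p≤k) λ ()
    go (suc k) p p≤k | inj₂ (q , q<p)
      with go k q (≤-pred (≤-trans q<p p≤k))
    ... | r , path , r≤q = r , path , ≤-trans r≤q (<⇒≤ q<p)

  geodesic⇒shortest : ∀ {x y} (p : Walk H x y) →
                      Geodesic H p → IsShortestPath {H = H} p
  geodesic⇒shortest p geo with path-or-shorter p
  ... | inj₁ path      = path , λ q _ → geo q
  ... | inj₂ (q , q<p) = contradiction (geo q) (<⇒≱ q<p)

  shortest⇒geodesic : ∀ {x y} (p : Walk H x y) →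
                      IsShortestPath {H = H} p → Geodesic H p
  shortest⇒geodesic p (_ , minimal) q with toPath q
  ... | r , path , r≤q = ≤-trans (minimal r path) r≤q

  -- A shortest walk repeats no vertex, as a shortcut would beat it; a shortest path is beaten by no
  -- walk, as every walk can be cut down to a path.
  monitors⇔ : ∀ {x y e} → Monitors H x y e ⇔ MonitorsGeodesics H x y e
  monitors⇔ = mk⇔ (λ mon p geo → mon p (geodesic⇒shortest p geo))
                  (λ mon p sp → mon p (shortest⇒geodesic p sp))

-- The empty walk is a geodesic from a vertex to itself and contains no edge.
monitors⇒≢ : ∀ {H : Graph V} {x y e} → MonitorsGeodesics H x y e → x ≢ y
monitors⇒≢ mon refl = mon ε λ _ → z≤n

-- In the applications, c is d(x, y) − d(x′, y′).
transfer : ∀ {H : Graph V} {K : Graph W} {x y x′ y′ e e′} (c : ℕ) →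
  (∀ (p : Walk K x′ y′) → Σ (Walk H x y) λ P →
     len {H = H} P ≤ len {H = K} p + c
     × (LiesOn {H = H} e P → LiesOn {H = K} e′ p)) →
  (∀ (q : Walk H x y) → Σ (Walk K x′ y′) λ Q → len {H = K} Q + c ≤ len {H = H} q) →
  MonitorsGeodesics H x y e → MonitorsGeodesics K x′ y′ e′
transfer c extend restrict mon p geo with extend p
-- `P` is geodesic, since `len P ≤ len p + c ≤ len Q + c ≤ len q` for every `q`. So it contains `e`,
-- and `pull` carries this over to `p`.
... | P , P≤p+c , pull = pull (mon P λ q → let Q , Q+c≤q = restrict q in
        ≤-trans P≤p+c (≤-trans (+-monoˡ-≤ c (geo Q)) Q+c≤q))

sameEdge-flip : ∀ {u v : V} {e} → SameEdge (u , v) e → SameEdge (v , u) e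
sameEdge-flip (inj₁ (a , b)) = inj₂ (b , a)
sameEdge-flip (inj₂ (a , b)) = inj₁ (b , a)

module _ {H : Graph V} where

  len-◅◅ : ∀ {x y z} (p : Walk H x y) (q : Walk H y z) →
           len {H = H} (p ◅◅ q) ≡ len {H = H} p + len {H = H} q
  len-◅◅ ε       q = refl
  len-◅◅ (_ ◅ p) q = cong suc (len-◅◅ p q)

  liesOn-◅◅⁻ : ∀ {x y z e} (p : Walk H x y) {q : Walk H y z} →
    LiesOn {H = H} e (p ◅◅ q) → LiesOn {H = H} e p ⊎ LiesOn {H = H} e q
  liesOn-◅◅⁻ ε       on        = inj₂ on
  liesOn-◅◅⁻ (_ ◅ p) (inj₁ se) = inj₁ (inj₁ se)
  liesOn-◅◅⁻ (_ ◅ p) (inj₂ on) with liesOn-◅◅⁻ p on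
  ... | inj₁ on′ = inj₁ (inj₂ on′)
  ... | inj₂ on′ = inj₂ on′

  liesOn-swap : ∀ {x y u v} (p : Walk H x y) →
                LiesOn {H = H} (u , v) p → LiesOn {H = H} (v , u) p
  liesOn-swap (_ ◅ p) (inj₁ se) = inj₁ (sameEdge-flip se)
  liesOn-swap (_ ◅ p) (inj₂ on) = inj₂ (liesOn-swap p on)

monitors-swap : {H : Graph V} → ∀ {x y u v} →
  MonitorsGeodesics H x y (u , v) → MonitorsGeodesics H x y (v , u)
monitors-swap {H = H} mon p geo = liesOn-swap {H = H} p (mon p geo)

-- Every walk that leaves `w`, geodesic or not, starts with the only edge at `w`.
monitors-leafEdge : {H : Graph V} → ∀ {w s y} → (∀ {z} → Adj H w z → s ≡ z) →
  y ≢ w → MonitorsGeodesics H w y (w , s)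
monitors-leafEdge unique y≢w ε       _ = contradiction refl y≢w
monitors-leafEdge unique y≢w (b ◅ p) _ = inj₁ (inj₁ (refl , unique b))

-- Subsets

-- Vertices of `H ⟨ C ⟩` carry a membership proof; its uniqueness makes them determined by their
-- first component.
∈-irrelevant : {C : Subset n} {x : Fin n} (i j : x ∈ C) → i ≡ j
∈-irrelevant = []=-irrelevant

∃∈-≡ : {C : Subset n} {x y : ∃ (_∈ C)} → proj₁ x ≡ proj₁ y → x ≡ y
∃∈-≡ {y = _ , y∈C} refl = cong (_ ,_) (∈-irrelevant _ y∈C)

∃∈-≟ : (C : Subset n) → DecidableEquality (∃ (_∈ C))
∃∈-≟ C (x , _) (y , _) with x ≟ y
... | yes x≡y = yes (∃∈-≡ x≡y)
... | no  x≢y = no (x≢y ∘ cong proj₁)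

module _ {P : Pred (Fin n) 0ℓ} (P? : Decidable P) where

  comprehension : Subset n
  comprehension = tabulate (λ x → does (P? x))

  ∈-comprehension⁺ : ∀ {x} → P x → x ∈ comprehension
  ∈-comprehension⁺ {x} px =
    lookup⇒[]= x _ (trans (lookup∘tabulate _ x) (dec-true (P? x) px))

  ∈-comprehension⁻ : ∀ {x} → x ∈ comprehension → P x
  ∈-comprehension⁻ {x} x∈
    with P? x | trans (sym (lookup∘tabulate (λ y → does (P? y)) x)) ([]=⇒lookup x∈)
  ... | yes px | _ = px

1<∣p∣ : ∀ {p : Subset n} {x y} → x ∈ p → y ∈ p → x ≢ y → 1 < ∣ p ∣
1<∣p∣ {p = p} {x} {y} x∈p y∈p x≢y =
  ≤-trans (s≤s (≤-trans (s≤s z≤n) (x∈p⇒∣p-x∣<∣p∣ (x∈p∧x≢y⇒x∈p-y y∈p (x≢y ∘ sym)))))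
          (x∈p⇒∣p-x∣<∣p∣ x∈p)

∣p∣≡1⇒≡ : ∀ {p : Subset n} {x y} → ∣ p ∣ ≡ 1 → x ∈ p → y ∈ p → x ≡ y
∣p∣≡1⇒≡ {x = x} {y} eq x∈p y∈p =
  decidable-stable (x ≟ y) λ x≢y → <-irrefl (sym eq) (1<∣p∣ x∈p y∈p x≢y)

∣p∣≢1⇒another : ∀ {p : Subset n} {x} → ∣ p ∣ ≢ 1 → x ∈ p → ∃ λ y → y ≢ x × y ∈ p
∣p∣≢1⇒another {p = p} {x} ≢1 x∈p with any? (λ y → ¬? (y ≟ x) ×-dec (y ∈? p))
... | yes found = found
... | no  ∄y = contradiction (trans (cong ∣_∣ p≡⁅x⁆) (∣⁅x⁆∣≡1 x)) ≢1
  where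
  p≡⁅x⁆ : p ≡ ⁅ x ⁆
  p≡⁅x⁆ = ⊆-antisym
    (λ {y} y∈p → Equivalence.from x∈⁅y⁆⇔x≡y
       (decidable-stable (y ≟ x) λ y≢x → ∄y (y , y≢x , y∈p)))
    (λ y∈ → subst (_∈ p) (sym (x∈⁅y⁆⇒x≡y x y∈)) x∈p)

∣p∪q∣≤∣p∣+∣q∣ : (p q : Subset n) → ∣ p ∪ q ∣ ≤ ∣ p ∣ + ∣ q ∣
∣p∪q∣≤∣p∣+∣q∣ []            []            = z≤n
∣p∪q∣≤∣p∣+∣q∣ (inside  ∷ p) (t       ∷ q) =
  s≤s (≤-trans (∣p∪q∣≤∣p∣+∣q∣ p q) (+-monoʳ-≤ ∣ p ∣ (∣p∣≤∣x∷p∣ t q)))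
∣p∪q∣≤∣p∣+∣q∣ (outside ∷ p) (inside  ∷ q) =
  ≤-trans (s≤s (∣p∪q∣≤∣p∣+∣q∣ p q)) (≤-reflexive (sym (+-suc ∣ p ∣ ∣ q ∣)))
∣p∪q∣≤∣p∣+∣q∣ (outside ∷ p) (outside ∷ q) = ∣p∪q∣≤∣p∣+∣q∣ p q

∣⁅x⁆∪p∣≤1+∣p∣ : (x : Fin n) (p : Subset n) → ∣ ⁅ x ⁆ ∪ p ∣ ≤ suc ∣ p ∣
∣⁅x⁆∪p∣≤1+∣p∣ x p = ≤-trans (∣p∪q∣≤∣p∣+∣q∣ ⁅ x ⁆ p)
                            (≤-reflexive (cong (_+ ∣ p ∣) (∣⁅x⁆∣≡1 x)))

image : ∀ {m} → (Fin m → Fin n) → Subset m → Subset n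
image f []            = ⊥
image f (inside  ∷ p) = ⁅ f zero ⁆ ∪ image (f ∘ suc) p
image f (outside ∷ p) = image (f ∘ suc) p

∈-image : ∀ {m} (f : Fin m → Fin n) {p x} → x ∈ p → f x ∈ image f p
∈-image f here = x∈p∪q⁺ (inj₁ (x∈⁅x⁆ (f zero)))
∈-image f {inside  ∷ p} (there x∈p) = x∈p∪q⁺ (inj₂ (∈-image (f ∘ suc) x∈p))
∈-image f {outside ∷ p} (there x∈p) = ∈-image (f ∘ suc) x∈p

∣image∣≤ : ∀ {m} (f : Fin m → Fin n) p → ∣ image f p ∣ ≤ ∣ p ∣
∣image∣≤ {n} f []     = ≤-reflexive (∣⊥∣≡0 n)
∣image∣≤ f (inside  ∷ p) =
  ≤-trans (∣⁅x⁆∪p∣≤1+∣p∣ (f zero) (image (f ∘ suc) p)) (s≤s (∣image∣≤ (f ∘ suc) p))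
∣image∣≤ f (outside ∷ p) = ∣image∣≤ (f ∘ suc) p

-- MEG-sets

-- A form of the notion that does not quantify over components; `IsMEGSet` follows by `fromIsMEG`.
-- The walks put `x` and `y` in the component of the edge, where monitoring cannot hold vacuously.
record IsMEG (H : Graph (Fin n)) (M : Subset n) : Set where
  field
    monitored : ∀ {u v} → Adj H u v → ∃₂ λ x y →
      (x ∈ M × Walk H u x) × (y ∈ M × Walk H u y) × MonitorsGeodesics H x y (u , v)
    nonIsolated : ∀ {x} → x ∈ M → ∃ (Adj H x)

module _ {H : Graph (Fin n)} {C : Subset n}
         (closed : ∀ {x y} → x ∈ C → Adj H x y → y ∈ C) where

  embed : ∀ {x y} (p : Walk (H ⟨ C ⟩) x y) →
    Σ (Walk H (proj₁ x) (proj₁ y)) λ q →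
      len {H = H} q ≡ len {H = H ⟨ C ⟩} p
      × (∀ {u v} → LiesOn {H = H} (proj₁ u , proj₁ v) q → LiesOn {H = H ⟨ C ⟩} (u , v) p)
  embed ε = ε , refl , id
  embed (a ◅ p) with embed p
  ... | q , q≡p , pull = a ◅ q , cong suc q≡p , λ where
    (inj₁ (inj₁ (e , f))) → inj₁ (inj₁ (∃∈-≡ e , ∃∈-≡ f))
    (inj₁ (inj₂ (e , f))) → inj₁ (inj₂ (∃∈-≡ e , ∃∈-≡ f))
    (inj₂ on)             → inj₂ (pull on)

  -- `closed` supplies the membership proof at each step: a walk that starts in `C` cannot leave it.
  confine : ∀ {x y} (x∈C : x ∈ C) (y∈C : y ∈ C) (p : Walk H x y) →
    Σ (Walk (H ⟨ C ⟩) (x , x∈C) (y , y∈C)) λ q →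
      len {H = H ⟨ C ⟩} q ≡ len {H = H} p
      × (∀ {u v} → LiesOn {H = H ⟨ C ⟩} (u , v) q → LiesOn {H = H} (proj₁ u , proj₁ v) p)
  confine x∈C y∈C ε with ∈-irrelevant x∈C y∈C
  ... | refl = ε , refl , λ ()
  confine x∈C y∈C (a ◅ p) with confine (closed x∈C a) y∈C p
  ... | q , q≡p , pull = a ◅ q , cong suc q≡p , λ where
    (inj₁ (inj₁ (refl , refl))) → inj₁ (inj₁ (refl , refl))
    (inj₁ (inj₂ (refl , refl))) → inj₁ (inj₂ (refl , refl))
    (inj₂ on)                   → inj₂ (pull on)

  -- Walks between vertices of `C` correspond in `H` and `H ⟨ C ⟩` with equal lengths, so the shift
  -- in `transfer` is 0.
  monitors-⟨⟩⁺ : ∀ {x y u v} →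
    MonitorsGeodesics H (proj₁ x) (proj₁ y) (proj₁ u , proj₁ v) →
    MonitorsGeodesics (H ⟨ C ⟩) x y (u , v)
  monitors-⟨⟩⁺ = transfer {H = H} {K = H ⟨ C ⟩} 0
    (λ p → let q , q≡p , pull = embed p in
       q , ≤-reflexive (trans q≡p (sym (+-identityʳ _))) , pull)
    (λ p → let q , q≡p , _ = confine _ _ p in
       q , ≤-reflexive (trans (+-identityʳ _) q≡p))

  monitors-⟨⟩⁻ : ∀ {x y u v} →
    MonitorsGeodesics (H ⟨ C ⟩) x y (u , v) →
    MonitorsGeodesics H (proj₁ x) (proj₁ y) (proj₁ u , proj₁ v)
  monitors-⟨⟩⁻ = transfer {H = H ⟨ C ⟩} {K = H} 0
    (λ p → let q , q≡p , pull = confine _ _ p in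
       q , ≤-reflexive (trans q≡p (sym (+-identityʳ _))) , pull)
    (λ p → let q , q≡p , _ = embed p in
       q , ≤-reflexive (trans (+-identityʳ _) q≡p))

module _ {H : Graph (Fin n)} where

  component-closed : ∀ {C} → IsComponent H C → ∀ {x y} → x ∈ C → Adj H x y → y ∈ C
  component-closed (_ , comp) x∈C a = Equivalence.from (comp _ x∈C _) (a ◅ ε)

  fromIsMEG : ∀ {M} → IsMEG H M → IsMEGSet H M
  fromIsMEG {M} meg C isComp@(_ , comp) = edges , isolated
    where
    open IsMEG meg
    edges : IsMEGSetᶜ (H ⟨ C ⟩) (λ x → proj₁ x ∈ M)
    edges (u , u∈C) v a with monitored a
    ... | x , y , (x∈M , u→x) , (y∈M , u→y) , mon =
      (x , Equivalence.from (comp u u∈C x) u→x) ,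
      (y , Equivalence.from (comp u u∈C y) u→y) , x∈M , y∈M ,
      Equivalence.from (monitors⇔ (∃∈-≟ C) (H ⟨ C ⟩))
        (monitors-⟨⟩⁺ {H = H} (component-closed isComp) mon)
    isolated : ∣ C ∣ ≡ 1 → ∀ x → x ∈ C → x ∉ M
    isolated ∣C∣≡1 x x∈C x∈M with nonIsolated x∈M
    ... | y , a with ∣p∣≡1⇒≡ ∣C∣≡1 x∈C (component-closed isComp x∈C a)
    ...   | refl = irrefl H a

  -- A vertex without neighbours is a component by itself, and the clause of `IsMEGSet` on
  -- components of size 1 keeps it out of `M`.
  nonIsolated⁺ : ∀ {M} → IsMEGSet H M → ∀ {x} → x ∈ M → ∃ (Adj H x)
  nonIsolated⁺ meg {x} x∈M with any? (adj? H x)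
  ... | yes found = found
  ... | no  none  = contradiction x∈M
    (proj₂ (meg ⁅ x ⁆ ((x , x∈⁅x⁆ x) , comp)) (∣⁅x⁆∣≡1 x) x (x∈⁅x⁆ x))
    where
    comp : ∀ z → z ∈ ⁅ x ⁆ → ∀ y → (y ∈ ⁅ x ⁆ ⇔ Walk H z y)
    comp z z∈ y with x∈⁅y⁆⇒x≡y x z∈
    ... | refl = mk⇔ to from
      where
      to : y ∈ ⁅ x ⁆ → Walk H x y
      to y∈ with x∈⁅y⁆⇒x≡y x y∈
      ... | refl = ε
      from : Walk H x y → y ∈ ⁅ x ⁆
      from ε       = x∈⁅x⁆ x
      from (a ◅ _) = contradiction (_ , a) none

  -- The component is an argument because each use knows it: all vertices for `G`, the complement of
  -- `L` for `G′`, a class of labels in the examples.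
  monitored⁺ : ∀ {M C} → IsMEGSet H M → IsComponent H C → ∀ {u v} → u ∈ C → Adj H u v →
    ∃₂ λ x y → x ∈ M × y ∈ M × MonitorsGeodesics H x y (u , v)
  monitored⁺ {C = C} meg isComp u∈C a
    with proj₁ (meg C isComp) (_ , u∈C) (_ , component-closed isComp u∈C a) a
  ... | x , y , x∈M , y∈M , mon = proj₁ x , proj₁ y , x∈M , y∈M ,
    monitors-⟨⟩⁻ {H = H} (component-closed isComp)
      (Equivalence.to (monitors⇔ (∃∈-≟ C) (H ⟨ C ⟩)) mon)

  -- One edge already forces two vertices. This is the lower bound on meg in the examples.
  1<∣MEG∣ : ∀ {M C} → IsMEGSet H M → IsComponent H C → ∀ {u v} → u ∈ C → Adj H u v →
            1 < ∣ M ∣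
  1<∣MEG∣ meg isComp u∈C a with monitored⁺ meg isComp u∈C a
  ... | x , y , x∈M , y∈M , mon = 1<∣p∣ x∈M y∈M (monitors⇒≢ {H = H} mon)

  ⊤-isComponent : Connected H → IsComponent H ⊤
  ⊤-isComponent (x , walk) = (x , ∈⊤) , λ x _ y → mk⇔ (λ _ → walk x y) (λ _ → ∈⊤)

-- Removing leaves

-- All that the two constructions of MEG-sets use of the removal, free of degrees and edge lists.
-- The vertices of `L` remain in `G′` as isolated vertices; those outside `L` are called the core.
record Pruning (G G′ : Graph (Fin n)) (L : Subset n) : Set where
  field
    connected : ∀ x y → Walk G x y
    support   : ∀ {w} → w ∈ L → ∃ (Adj G w)
    unique    : ∀ {w y z} → w ∈ L → Adj G w y → Adj G w z → y ≡ z
    core      : ∀ {w s} → w ∈ L → Adj G w s → s ∉ L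
    another   : ∀ {w s} → w ∈ L → Adj G w s → ∃ λ z → z ≢ w × Adj G s z
    keep      : ∀ {u v} → Adj G u v → u ∉ L → v ∉ L → Adj G′ u v
    adj⊆      : ∀ {u v} → Adj G′ u v → Adj G u v
    adj∉      : ∀ {u v} → Adj G′ u v → u ∉ L

module _ {G G′ : Graph (Fin n)} {L : Subset n} (pruning : Pruning G G′ L) where

  open Pruning pruning

  -- Anchor x s i: the retraction takes x to s, at distance i.
  data Anchor (x : Fin n) : Fin n → ℕ → Set where
    stay : x ∉ L → Anchor x x 0
    drop : ∀ {s} → x ∈ L → Adj G x s → Anchor x s 1

  anchor : ∀ x → ∃₂ λ s i → Anchor x s i
  anchor x with x ∈? L
  ... | no  x∉L = x , 0 , stay x∉L
  ... | yes x∈L = let s , a = support x∈L in s , 1 , drop x∈L a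

  Retracts : ∀ {x y s t} → Walk G x y → Walk G′ s t → Set
  Retracts p q = ∀ {e} → LiesOn {H = G′} e q → LiesOn {H = G} e p

  -- An edge of the core survives. A leaf edge shrinks to the empty walk, and the edge saved pays
  -- for the distance from the leaf to its support; `core` excludes an edge with two leaves.
  retractEdge : ∀ {x y s t i j} → Anchor x s i → Anchor y t j → (a : Adj G x y) →
    Σ (Walk G′ s t) λ q → len {H = G′} q + (i + j) ≤ 1 × Retracts (a ◅ ε) q
  retractEdge (stay x∉L)   (stay y∉L)   a = keep a x∉L y∉L ◅ ε , ≤-refl , id
  retractEdge (stay x∉L)   (drop y∈L b) a with unique y∈L b (adj-sym G a)
  ... | refl = ε , ≤-refl , λ ()
  retractEdge (drop x∈L b) (stay y∉L)   a with unique x∈L b a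
  ... | refl = ε , ≤-refl , λ ()
  retractEdge (drop x∈L _) (drop y∈L _) a = contradiction y∈L (core x∈L a)

  -- The first edge is split off because the bound fails for the empty walk at a leaf, where `i + j`
  -- is 2.
  retract : ∀ {x y z s t i j} → Anchor x s i → Anchor y t j →
    (a : Adj G x z) (p : Walk G z y) →
    Σ (Walk G′ s t) λ q →
      len {H = G′} q + (i + j) ≤ suc (len {H = G} p) × Retracts (a ◅ p) q
  retract s t a ε = retractEdge s t a
  retract {i = i} {j} s t a (b ◅ p) with anchor _
  ... | _ , k , r with retractEdge s r a | retract r t b p
  ... | q₁ , q₁≤1 , pull₁ | q₂ , q₂≤p , pull₂ = q₁ ◅◅ q₂ , bound , pull
    where
    open ≤-Reasoning
    l₁ = len {H = G′} q₁
    l₂ = len {H = G′} q₂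
    -- The middle vertex may be a leaf too, at distance `k` from its anchor. Its saving counts in
    -- both halves, and the bound forgoes it.
    bound : len {H = G′} (q₁ ◅◅ q₂) + (i + j) ≤ suc (suc (len {H = G} p))
    bound = begin
      len {H = G′} (q₁ ◅◅ q₂) + (i + j) ≡⟨ cong (_+ (i + j)) (len-◅◅ {H = G′} q₁ q₂) ⟩
      (l₁ + l₂) + (i + j)               ≡⟨ interchange l₁ l₂ i j ⟩
      (l₁ + i) + (l₂ + j)               ≤⟨ +-mono-≤ (+-monoʳ-≤ l₁ (m≤m+n i k)) (+-monoʳ-≤ l₂ (m≤n+m j k)) ⟩
      (l₁ + (i + k)) + (l₂ + (k + j))   ≤⟨ +-mono-≤ q₁≤1 q₂≤p ⟩
      suc (suc (len {H = G} p))         ∎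
    pull : Retracts (a ◅ b ◅ p) (q₁ ◅◅ q₂)
    pull on with liesOn-◅◅⁻ {H = G′} q₁ on
    ... | inj₂ on₂ = inj₂ (pull₂ on₂)
    ... | inj₁ on₁ with pull₁ on₁
    ...   | inj₁ se = inj₁ se

  retractCore : ∀ {x y} → x ∉ L → y ∉ L → (p : Walk G x y) →
    Σ (Walk G′ x y) λ q → len {H = G′} q + 0 ≤ len {H = G} p × Retracts p q
  retractCore x∉L y∉L ε       = ε , z≤n , λ ()
  retractCore x∉L y∉L (a ◅ p) = retract (stay x∉L) (stay y∉L) a p

  anchor∉ : ∀ {x s i} → Anchor x s i → s ∉ L
  anchor∉ (stay x∉L)   = x∉L
  anchor∉ (drop x∈L a) = core x∈L a

  core-connected : ∀ {x y} → x ∉ L → y ∉ L → Walk G′ x y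
  core-connected x∉L y∉L = proj₁ (retractCore x∉L y∉L (connected _ _))

  include : ∀ {x y} (p : Walk G′ x y) → Σ (Walk G x y) λ q →
    len {H = G} q ≡ len {H = G′} p × (∀ {e} → LiesOn {H = G} e q → LiesOn {H = G′} e p)
  include ε = ε , refl , id
  include (a ◅ p) with include p
  ... | q , q≡p , pull = adj⊆ a ◅ q , cong suc q≡p , λ where
    (inj₁ se) → inj₁ se
    (inj₂ on) → inj₂ (pull on)

  -- Retracting walks of `G` keeps the core connected, and by `adj∉` no edge of `G′` leaves it.
  core-isComponent : ∀ {x} → x ∉ L → IsComponent G′ (∁ L)
  core-isComponent {x} x∉L = (x , x∉p⇒x∈∁p x∉L) , λ x x∈ y → mk⇔
    (λ y∈ → core-connected (x∈∁p⇒x∉p x∈) (x∈∁p⇒x∉p y∈)) (stays x∈)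
    where
    stays : ∀ {x y} → x ∈ ∁ L → Walk G′ x y → y ∈ ∁ L
    stays x∈ ε       = x∈
    stays x∈ (a ◅ p) = stays (x∉p⇒x∈∁p (adj∉ (adj-sym G′ a))) p

  -- The leg from a vertex to its anchor uses at most an edge at a leaf, so it misses every edge
  -- with both ends in the core.
  enter : ∀ {x s i u v} → Anchor x s i → u ∉ L → v ∉ L →
    Σ (Walk G x s) λ p → len {H = G} p ≡ i × ¬ LiesOn {H = G} (u , v) p
  enter (stay _)     u∉L v∉L = ε , refl , id
  enter (drop x∈L a) u∉L v∉L = a ◅ ε , refl , λ where
    (inj₁ (inj₁ (refl , _))) → u∉L x∈L
    (inj₁ (inj₂ (_ , refl))) → v∉L x∈L

  leave : ∀ {x s i u v} → Anchor x s i → u ∉ L → v ∉ L →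
    Σ (Walk G s x) λ p → len {H = G} p ≡ i × ¬ LiesOn {H = G} (u , v) p
  leave (stay _)     u∉L v∉L = ε , refl , id
  leave (drop x∈L a) u∉L v∉L = adj-sym G a ◅ ε , refl , λ where
    (inj₁ (inj₁ (_ , refl))) → v∉L x∈L
    (inj₁ (inj₂ (refl , _))) → u∉L x∈L

  -- The two legs lengthen a walk of `G′` by `i + j`, and retracting a walk from `x` to `y` saves as
  -- much. As the legs miss the edge, it has to lie on the part in `G′`.
  monitors-retract : ∀ {x y s t i j u v} → Anchor x s i → Anchor y t j →
    Adj G′ u v → MonitorsGeodesics G x y (u , v) → MonitorsGeodesics G′ s t (u , v)
  monitors-retract {x} {y} {s} {t} {i} {j} {u} {v} rx ry a mon =
    transfer {H = G} {K = G′} (i + j) extend restrict mon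
    where
    u∉L = adj∉ a
    v∉L = adj∉ (adj-sym G′ a)
    extend : ∀ (p : Walk G′ s t) → Σ (Walk G x y) λ P →
      len {H = G} P ≤ len {H = G′} p + (i + j)
      × (LiesOn {H = G} (u , v) P → LiesOn {H = G′} (u , v) p)
    extend p with include p | enter rx u∉L v∉L | leave ry u∉L v∉L
    ... | p′ , p′≡p , pull | q , q≡i , ∉q | r , r≡j , ∉r =
      q ◅◅ p′ ◅◅ r , ≤-reflexive bound , back
      where
      bound : len {H = G} (q ◅◅ p′ ◅◅ r) ≡ len {H = G′} p + (i + j)
      bound = trans (len-◅◅ {H = G} q (p′ ◅◅ r))
        (trans (cong₂ _+_ q≡i (trans (len-◅◅ {H = G} p′ r) (cong₂ _+_ p′≡p r≡j)))
               (x∙yz≈y∙xz i (len {H = G′} p) j))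
      back : LiesOn {H = G} (u , v) (q ◅◅ p′ ◅◅ r) → LiesOn {H = G′} (u , v) p
      back on with liesOn-◅◅⁻ {H = G} q on
      ... | inj₁ on′ = contradiction on′ ∉q
      ... | inj₂ on′ with liesOn-◅◅⁻ {H = G} p′ on′
      ...   | inj₁ on″ = pull on″
      ...   | inj₂ on″ = contradiction on″ ∉r
    restrict : ∀ (q : Walk G x y) →
               Σ (Walk G′ s t) λ Q → len {H = G′} Q + (i + j) ≤ len {H = G} q
    -- The bound could fail here, but a vertex paired with itself monitors nothing.
    restrict ε       = contradiction refl (monitors⇒≢ {H = G} mon)
    restrict (b ◅ q) with retract rx ry b q
    ... | Q , Q≤q , _ = Q , Q≤q

  -- Core vertices have the same distance in both graphs, and a retracted walk uses only edges of
  -- the original one.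
  monitors-include : ∀ {x y e} → x ∉ L → y ∉ L →
    MonitorsGeodesics G′ x y e → MonitorsGeodesics G x y e
  monitors-include x∉L y∉L = transfer {H = G′} {K = G} 0
    (λ p → let q , q≤p , pull = retractCore x∉L y∉L p in
       q , subst (_≤ _) (+-identityʳ _) (≤-trans q≤p (≤-reflexive (sym (+-identityʳ _)))) , pull)
    (λ p → let q , q≡p , _ = include p in
       q , ≤-reflexive (trans (+-identityʳ _) q≡p))

  prune-IsMEG : ∀ {M} → IsMEGSet G M → ∃ λ M′ → IsMEG G′ M′ × ∣ M′ ∣ ≤ ∣ M ∣
  prune-IsMEG {M} meg = M′ , record { monitored = monitored ; nonIsolated = nonIsolated } ,
    ≤-trans (∣p∩q∣≤∣p∣ (image ρ M) N) (∣image∣≤ ρ M)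
    where
    ρ : Fin n → Fin n
    ρ = proj₁ ∘ anchor
    nonIsolated? : Decidable (λ x → ∃ (Adj G′ x))
    nonIsolated? x = any? (adj? G′ x)
    N  = comprehension nonIsolated?
    -- The intersection matters when the core is a single vertex: it is isolated in `G′` and has to
    -- be left out.
    M′ = image ρ M ∩ N
    nonIsolated : ∀ {x} → x ∈ M′ → ∃ (Adj G′ x)
    nonIsolated x∈ = ∈-comprehension⁻ nonIsolated? (proj₂ (x∈p∩q⁻ (image ρ M) N x∈))
    -- As the core is connected, one edge of `G′` makes all its vertices non-isolated, so `N`
    -- discards none of the vertices needed to monitor.
    core∈N : ∀ {u v} → Adj G′ u v → ∀ {x} → x ∉ L → x ∈ N
    core∈N {u} {v} a {x} x∉L = ∈-comprehension⁺ nonIsolated? (firstStep (core-connected x∉L (adj∉ a)))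
      where
      firstStep : Walk G′ x u → ∃ (Adj G′ x)
      firstStep ε       = v , a
      firstStep (b ◅ _) = _ , b
    monitored : ∀ {u v} → Adj G′ u v → ∃₂ λ x y →
      (x ∈ M′ × Walk G′ u x) × (y ∈ M′ × Walk G′ u y) × MonitorsGeodesics G′ x y (u , v)
    monitored {u} a
      with monitored⁺ meg (⊤-isComponent {H = G} (u , connected)) ∈⊤ (adj⊆ a)
    ... | x , y , x∈M , y∈M , mon =
      ρ x , ρ y , project x∈M , project y∈M ,
      monitors-retract (proj₂ (proj₂ (anchor x))) (proj₂ (proj₂ (anchor y))) a mon
      where
      project : ∀ {z} → z ∈ M → ρ z ∈ M′ × Walk G′ u (ρ z)
      project {z} z∈M = x∈p∩q⁺ (∈-image ρ z∈M , core∈N a ρz∉L) , core-connected (adj∉ a) ρz∉L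
        where ρz∉L = anchor∉ (proj₂ (proj₂ (anchor z)))

  graft-IsMEG : ∀ {M′} → IsMEGSet G′ M′ → IsMEG G (M′ ∪ L)
  graft-IsMEG {M′} meg = record { monitored = monitored ; nonIsolated = nonIsolated }
    where
    M = M′ ∪ L
    M′⊆ : ∀ {x} → x ∈ M′ → x ∈ M
    M′⊆ = x∈p∪q⁺ ∘ inj₁
    L⊆ : ∀ {x} → x ∈ L → x ∈ M
    L⊆ = x∈p∪q⁺ ∘ inj₂
    M′-core : ∀ {x} → x ∈ M′ → x ∉ L
    M′-core x∈M′ = adj∉ (proj₂ (nonIsolated⁺ {H = G′} meg x∈M′))
    nonIsolated : ∀ {x} → x ∈ M → ∃ (Adj G x)
    nonIsolated x∈M with x∈p∪q⁻ M′ L x∈M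
    ... | inj₁ x∈M′ = let y , a = nonIsolated⁺ {H = G′} meg x∈M′ in y , adj⊆ a
    ... | inj₂ x∈L  = support x∈L
    monitored′ : ∀ {u v} → Adj G′ u v →
      ∃₂ λ x y → x ∈ M′ × y ∈ M′ × MonitorsGeodesics G′ x y (u , v)
    monitored′ a = monitored⁺ meg (core-isComponent (adj∉ a)) (x∉p⇒x∈∁p (adj∉ a)) a
    -- Let `z` be another neighbour of the support. If `z` is a leaf in `L`, it serves itself;
    -- otherwise the edge from `s` to `z` survives in `G′`, and a vertex of `M′` that helps to
    -- monitor it lies in the core, hence differs from `w`.
    other : ∀ {w s} → w ∈ L → Adj G w s → ∃ λ y → y ∈ M × y ≢ w
    other w∈L a with another w∈L a
    ... | z , z≢w , b with z ∈? L
    ...   | yes z∈L = z , L⊆ z∈L , z≢w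
    ...   | no  z∉L with monitored′ (keep b (core w∈L a) z∉L)
    ...     | x , _ , x∈M′ , _ = x , M′⊆ x∈M′ , λ { refl → M′-core x∈M′ w∈L }
    monitored : ∀ {u v} → Adj G u v → ∃₂ λ x y →
      (x ∈ M × Walk G u x) × (y ∈ M × Walk G u y) × MonitorsGeodesics G x y (u , v)
    monitored {u} {v} a with u ∈? L | v ∈? L
    ... | yes u∈L | _ = let y , y∈M , y≢u = other u∈L a in
      u , y , (L⊆ u∈L , ε) , (y∈M , connected u y) , monitors-leafEdge {H = G} (unique u∈L a) y≢u
    ... | no _ | yes v∈L = let y , y∈M , y≢v = other v∈L (adj-sym G a) in
      v , y , (L⊆ v∈L , connected u v) , (y∈M , connected u y) ,
      monitors-swap {H = G} (monitors-leafEdge {H = G} (unique v∈L (adj-sym G a)) y≢v)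
    ... | no u∉L | no v∉L with monitored′ (keep a u∉L v∉L)
    ...   | x , y , x∈M′ , y∈M′ , mon =
      x , y , (M′⊆ x∈M′ , connected u x) , (M′⊆ y∈M′ , connected u y) ,
      monitors-include (M′-core x∈M′) (M′-core y∈M′) mon

  meg-prune : ∀ {m m′} → HasMeg G m → HasMeg G′ m′ → m ≤ m′ + ∣ L ∣ × m′ ≤ m
  meg-prune ((M , meg , refl) , minimal) ((M′ , meg′ , refl) , minimal′) =
    ≤-trans (minimal (M′ ∪ L) (fromIsMEG (graft-IsMEG meg′))) (∣p∪q∣≤∣p∣+∣q∣ M′ L) ,
    (let N , megN , N≤M = prune-IsMEG meg in ≤-trans (minimal′ N (fromIsMEG megN)) N≤M)

-- Pendant edges

record IsPendantLeaf (G : Graph (Fin n)) (es : List (Fin n × Fin n)) (w : Fin n) : Set where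
  constructor pendantLeaf
  field
    {base}  : Fin n
    degree₁ : degree G w ≡ 1
    edge    : Adj G w base
    degree₂ : degree G base ≢ 1
    removed : Any (SameEdge (w , base)) es

-- An upper bound on the size is what turns `m ≤ m′ + ∣ L ∣` into `m ≤ m′ + l`.
record Leaves (G : Graph (Fin n)) (es : List (Fin n × Fin n)) : Set where
  field
    leaves  : Subset n
    size    : ∣ leaves ∣ ≤ length es
    sound   : ∀ {w} → w ∈ leaves → IsPendantLeaf G es w
    covers  : ∀ {u v} → Any (SameEdge (u , v)) es → u ∈ leaves ⊎ v ∈ leaves

pendantLeaves : {G : Graph (Fin n)} {es : List (Fin n × Fin n)} → All (Pendant G) es → Leaves G es
pendantLeaves {n} [] = record
  { leaves = ⊥ ; size = ≤-reflexive (∣⊥∣≡0 n) ; sound = ⊥-elim ∘ ∉⊥ ; covers = λ () }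
pendantLeaves {n} {G} {(u , v) ∷ es} (((a , _) , degrees) ∷ pendants) = extend degrees
  where
  open Leaves (pendantLeaves {G = G} pendants)
  add : ∀ w → IsPendantLeaf G ((u , v) ∷ es) w →
        (∀ {x y} → SameEdge (x , y) (u , v) → w ≡ x ⊎ w ≡ y) → Leaves G ((u , v) ∷ es)
  add w leaf end = record
    { leaves = ⁅ w ⁆ ∪ leaves
    ; size   = ≤-trans (∣⁅x⁆∪p∣≤1+∣p∣ w leaves) (s≤s size)
    ; sound  = λ {z} → [ (λ z∈ → subst (IsPendantLeaf G _) (sym (x∈⁅y⁆⇒x≡y w z∈)) leaf)
                       , (λ z∈ → let pendantLeaf d b d′ m = sound z∈ in pendantLeaf d b d′ (there m))
                       ]′ ∘ x∈p∪q⁻ ⁅ w ⁆ leaves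
    ; covers = λ where
        (here se)  → map-⊎ new new (end se)
        (there se) → map-⊎ old old (covers se)
    }
    where
    new : ∀ {x} → w ≡ x → x ∈ ⁅ w ⁆ ∪ leaves
    new refl = x∈p∪q⁺ (inj₁ (x∈⁅x⁆ w))
    old : ∀ {x} → x ∈ leaves → x ∈ ⁅ w ⁆ ∪ leaves
    old = x∈p∪q⁺ ∘ inj₂
  extend : (degree G u ≡ 1 × degree G v ≢ 1) ⊎ (degree G u ≢ 1 × degree G v ≡ 1) →
           Leaves G ((u , v) ∷ es)
  extend (inj₁ (d , d′)) = add u (pendantLeaf d a d′ (here (inj₁ (refl , refl)))) λ where
    (inj₁ (refl , _)) → inj₁ refl
    (inj₂ (_ , refl)) → inj₂ refl
  extend (inj₂ (d′ , d)) = add v (pendantLeaf d (adj-sym G a) d′ (here (inj₂ (refl , refl)))) λ where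
    (inj₁ (_ , refl)) → inj₂ refl
    (inj₂ (refl , _)) → inj₁ refl

module _ {G : Graph (Fin n)} {es : List (Fin n × Fin n)}
         (connected : ∀ x y → Walk G x y) (ls : Leaves G es) where

  open Leaves ls

  -- `degree G w` unfolds to the size of `comprehension (adj? G w)`, the set of neighbours.
  leaf-unique : ∀ {w y z} → w ∈ leaves → Adj G w y → Adj G w z → y ≡ z
  leaf-unique {w} w∈ a b = ∣p∣≡1⇒≡ (IsPendantLeaf.degree₁ (sound w∈))
    (∈-comprehension⁺ (adj? G w) a) (∈-comprehension⁺ (adj? G w) b)

  base-degree : ∀ {w s} → w ∈ leaves → Adj G w s → degree G s ≢ 1
  base-degree w∈ a with leaf-unique w∈ a (IsPendantLeaf.edge (sound w∈))
  ... | refl = IsPendantLeaf.degree₂ (sound w∈)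

  pruning : Pruning G (G ∖ es) leaves
  pruning = record
    { connected = connected
    ; support   = λ w∈ → _ , IsPendantLeaf.edge (sound w∈)
    ; unique    = leaf-unique
    ; core      = λ w∈ a s∈ → base-degree w∈ a (IsPendantLeaf.degree₁ (sound s∈))
    ; another   = λ {_} {s} w∈ a →
        let z , z≢w , z∈ = ∣p∣≢1⇒another (base-degree w∈ a)
                             (∈-comprehension⁺ (adj? G s) (adj-sym G a))
        in z , z≢w , ∈-comprehension⁻ (adj? G s) z∈
    ; keep      = λ a u∉ v∉ → a , [ u∉ , v∉ ]′ ∘ covers
    ; adj⊆      = proj₁
    ; adj∉      = kept∉
    }
    where
    -- The only edge at a leaf is the one listed in `es`.
    kept∉ : ∀ {u v} → Adj (G ∖ es) u v → u ∉ leaves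
    kept∉ (a , ∉es) u∈ with leaf-unique u∈ a (IsPendantLeaf.edge (sound u∈))
    ... | refl = ∉es (IsPendantLeaf.removed (sound u∈))

-- The difference in the theorem is taken in the integers, so it is not truncated at 0.
m≤n+o⇒m⊖o≤n : ∀ {m n o} → m ≤ n + o → m ⊖ o ≤ℤ + n
m≤n+o⇒m⊖o≤n {m} {n} {o} m≤n+o = ℤ.≤-trans (ℤ.⊖-monoˡ-≤ o m≤n+o)
  (ℤ.≤-reflexive (trans (ℤ.⊖-≥ (m≤n+m o n)) (cong +_ (m+n∸n≡m n o))))

pendantRemoval-bounds : {G : Graph (Fin n)} {k l : ℕ} {es : List (Fin n × Fin n)} →
  PendantRemoval G k l es → ∀ {m m′} → HasMeg G m → HasMeg (G ∖ es) m′ →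
  (m ⊖ l ≤ℤ + m′) × (m′ ≤ m)
pendantRemoval-bounds {G = G} {es = es} pr {m} {m′} meg meg′ =
  m≤n+o⇒m⊖o≤n (≤-trans (proj₁ bounds) (+-monoʳ-≤ m′ ∣L∣≤l)) , proj₂ bounds
  where
  open PendantRemoval pr
  ls : Leaves G es
  ls = pendantLeaves {G = G} pendant
  bounds = meg-prune (pruning (proj₂ connected) ls) meg meg′
  ∣L∣≤l = ≤-trans (Leaves.size ls) (≤-reflexive size)

-- Tightness

-- Labels constant along edges are constant along walks; vertices with equal labels are joined
-- through their representative.
numComponents : ∀ {c} {H : Graph (Fin n)} (label : Fin n → Fin c) (rep : Fin c → Fin n) →
  (∀ i → label (rep i) ≡ i) → (∀ {x y} → Adj H x y → label x ≡ label y) →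
  (∀ x → Walk H x (rep (label x))) → NumComponents H c
numComponents {H = H} label rep label-rep adj⇒≡ walk =
  label , (λ i → rep i , λ { refl → label-rep i }) , λ x y → mk⇔ (joined x y) walk⇒≡
  where
  joined : ∀ x y → label x ≡ label y → Walk H x y
  joined x y eq =
    walk x ◅◅ subst (λ i → Walk H (rep i) y) (sym eq) (reverse (adj-sym H) (walk y))
  walk⇒≡ : ∀ {x y} → Walk H x y → label x ≡ label y
  walk⇒≡ ε       = refl
  walk⇒≡ (a ◅ p) = trans (adj⇒≡ a) (walk⇒≡ p)

-- Equality of labels is decidable, unlike `Walk` as it stands, so a class of labels can be formed
-- as a `Subset`.
component : ∀ {c} {H : Graph (Fin n)} → NumComponents H c →
            ∀ u → ∃ λ C → u ∈ C × IsComponent H C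
component (label , _ , ≡⇔walk) u = C , u∈C , (u , u∈C) , λ x x∈C y → mk⇔
  (λ y∈C → Equivalence.to (≡⇔walk x y) (trans (∈⁻ x∈C) (sym (∈⁻ y∈C))))
  (λ walk → ∈⁺ (trans (sym (Equivalence.from (≡⇔walk x y) walk)) (∈⁻ x∈C)))
  where
  sameLabel? : Decidable (λ x → label x ≡ label u)
  sameLabel? x = label x ≟ label u
  C   = comprehension sameLabel?
  ∈⁺  = ∈-comprehension⁺ sameLabel?
  ∈⁻  = ∈-comprehension⁻ sameLabel?
  u∈C = ∈⁺ refl

hasMeg-2 : ∀ {c M u v} {H : Graph (Fin n)} → NumComponents H c → Adj H u v →
           IsMEG H M → ∣ M ∣ ≡ 2 → HasMeg H 2
hasMeg-2 {M = M} {u} {H = H} comps a meg ∣M∣≡2 with component {H = H} comps u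
... | _ , u∈C , isComp =
  (M , fromIsMEG meg , ∣M∣≡2) , λ M′ meg′ → 1<∣MEG∣ {H = H} meg′ isComp u∈C a

e₀ e₂ : Fin 3 × Fin 3
e₀ = 0F , 1F
e₂ = 2F , 1F

edges : List (Fin 3 × Fin 3)
edges = e₀ ∷ e₂ ∷ []

pattern 0→1 = here (inj₁ (refl , refl))
pattern 1→0 = here (inj₂ (refl , refl))
pattern 2→1 = there (here (inj₁ (refl , refl)))
pattern 1→2 = there (here (inj₂ (refl , refl)))

P₃ : Graph (Fin 3)
P₃ = record
  { Adj     = λ u v → Any (SameEdge (u , v)) edges
  ; adj?    = λ u v → Any.any? (sameEdge? (u , v)) edges
  ; adj-sym = Any.map sameEdge-flip
  ; irrefl  = λ where
      (here (inj₁ (refl , ())))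
      (here (inj₂ (refl , ())))
      (there (here (inj₁ (refl , ()))))
      (there (here (inj₂ (refl , ()))))
  }

P₃-connected : Connected P₃
P₃-connected = 0F , λ x y → toCentre x ◅◅ reverse (adj-sym P₃) (toCentre y)
  where
  toCentre : ∀ x → Walk P₃ x 1F
  toCentre 0F = 0→1 ◅ ε
  toCentre 1F = ε
  toCentre 2F = 2→1 ◅ ε

P₃-leafEdge : ∀ {w z} → w ≢ 1F → Adj P₃ w z → 1F ≡ z
P₃-leafEdge w≢1 0→1 = refl
P₃-leafEdge w≢1 2→1 = refl
P₃-leafEdge w≢1 1→0 = contradiction refl w≢1
P₃-leafEdge w≢1 1→2 = contradiction refl w≢1

P₃-numComponents : NumComponents P₃ 1
P₃-numComponents = numComponents {c = 1} {H = P₃} (λ _ → 0F) (λ _ → 1F) (λ { 0F → refl })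
  (λ _ → refl) (λ x → proj₂ P₃-connected x 1F)

P₃∖e₀-numComponents : NumComponents (P₃ ∖ (e₀ ∷ [])) 2
P₃∖e₀-numComponents = numComponents {c = 2} {H = P₃ ∖ (e₀ ∷ [])}
  (λ { 0F → 0F ; 1F → 1F ; 2F → 1F }) (λ { 0F → 0F ; 1F → 1F }) (λ { 0F → refl ; 1F → refl })
  (λ where
    (0→1 , kept) → contradiction 0→1 kept
    (1→0 , kept) → contradiction 1→0 kept
    (2→1 , _)    → refl
    (1→2 , _)    → refl)
  (λ { 0F → ε ; 1F → ε ; 2F → (2→1 , from-yes (¬? (Any.any? (sameEdge? (2F , 1F)) (e₀ ∷ [])))) ◅ ε })

P₃∖e₂-numComponents : NumComponents (P₃ ∖ (e₂ ∷ [])) 2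
P₃∖e₂-numComponents = numComponents {c = 2} {H = P₃ ∖ (e₂ ∷ [])}
  (λ { 0F → 1F ; 1F → 1F ; 2F → 0F }) (λ { 0F → 2F ; 1F → 1F }) (λ { 0F → refl ; 1F → refl })
  (λ where
    (2→1 , kept) → contradiction 0→1 kept
    (1→2 , kept) → contradiction 1→0 kept
    (0→1 , _)    → refl
    (1→0 , _)    → refl)
  (λ { 2F → ε ; 1F → ε ; 0F → (0→1 , from-yes (¬? (Any.any? (sameEdge? (0F , 1F)) (e₂ ∷ [])))) ◅ ε })

P₃-pendant : All (Pendant P₃) edges
P₃-pendant =
  ((0→1 , 1 , 2 , P₃-numComponents , P₃∖e₀-numComponents , ≤-refl) , inj₁ (refl , λ ())) ∷
  ((2→1 , 1 , 2 , P₃-numComponents , P₃∖e₂-numComponents , ≤-refl) , inj₁ (refl , λ ())) ∷ []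

P₃-distinct : Distinct edges
P₃-distinct = (from-yes (¬? (sameEdge? e₀ e₂)) ∷ []) ∷ [] ∷ []

P₃-numPendant : NumPendant P₃ 2
-- The list is complete because a pendant edge is an edge, and adjacency in `P₃` is membership in
-- `edges`.
P₃-numPendant = edges , P₃-distinct , P₃-pendant , (λ _ _ → proj₁ ∘ proj₁) , refl

P₃-meg : HasMeg P₃ 2
P₃-meg = hasMeg-2 {H = P₃} P₃-numComponents 0→1
  record { monitored = monitored ; nonIsolated = nonIsolated } refl
  where
  M : Subset 3
  M = inside ∷ outside ∷ inside ∷ []
  end₀ : ∀ {u} → 0F ∈ M × Walk P₃ u 0F
  end₀ = here , proj₂ P₃-connected _ 0F
  end₂ : ∀ {u} → 2F ∈ M × Walk P₃ u 2F
  end₂ = there (there here) , proj₂ P₃-connected _ 2F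
  from₀ : MonitorsGeodesics P₃ 0F 2F e₀
  from₀ = monitors-leafEdge {H = P₃} (P₃-leafEdge λ ()) λ ()
  from₂ : MonitorsGeodesics P₃ 2F 0F e₂
  from₂ = monitors-leafEdge {H = P₃} (P₃-leafEdge λ ()) λ ()
  monitored : ∀ {u v} → Adj P₃ u v → ∃₂ λ x y →
    (x ∈ M × Walk P₃ u x) × (y ∈ M × Walk P₃ u y) × MonitorsGeodesics P₃ x y (u , v)
  monitored 0→1 = 0F , 2F , end₀ , end₂ , from₀
  monitored 1→0 = 0F , 2F , end₀ , end₂ , monitors-swap {H = P₃} from₀
  monitored 2→1 = 2F , 0F , end₂ , end₀ , from₂
  monitored 1→2 = 2F , 0F , end₂ , end₀ , monitors-swap {H = P₃} from₂
  nonIsolated : ∀ {x} → x ∈ M → ∃ (Adj P₃ x)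
  nonIsolated {0F} _ = 1F , 0→1
  nonIsolated {1F} (there ())
  nonIsolated {2F} _ = 1F , 2→1

P₃∖e₀-meg : HasMeg (P₃ ∖ (e₀ ∷ [])) 2
P₃∖e₀-meg = hasMeg-2 {H = H} P₃∖e₀-numComponents 2~1
  record { monitored = monitored ; nonIsolated = nonIsolated } refl
  where
  H : Graph (Fin 3)
  H = P₃ ∖ (e₀ ∷ [])
  M : Subset 3
  -- The ends of the remaining edge; vertex 0 is now isolated and stays out.
  M = outside ∷ inside ∷ inside ∷ []
  2~1 : Adj H 2F 1F
  2~1 = 2→1 , from-yes (¬? (Any.any? (sameEdge? (2F , 1F)) (e₀ ∷ [])))
  from₂ : MonitorsGeodesics H 2F 1F e₂
  from₂ = monitors-leafEdge {H = H} (P₃-leafEdge (λ ()) ∘ proj₁) λ ()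
  monitored : ∀ {u v} → Adj H u v → ∃₂ λ x y →
    (x ∈ M × Walk H u x) × (y ∈ M × Walk H u y) × MonitorsGeodesics H x y (u , v)
  monitored (0→1 , kept) = contradiction 0→1 kept
  monitored (1→0 , kept) = contradiction 1→0 kept
  monitored (2→1 , _) =
    2F , 1F , (there (there here) , ε) , (there here , 2~1 ◅ ε) , from₂
  monitored (1→2 , _) =
    2F , 1F , (there (there here) , adj-sym H {2F} 2~1 ◅ ε) , (there here , ε) ,
    monitors-swap {H = H} from₂
  nonIsolated : ∀ {x} → x ∈ M → ∃ (Adj H x)
  nonIsolated {1F} _ = 2F , adj-sym H {2F} 2~1
  nonIsolated {2F} _ = 1F , 2~1

P₃∖edges-meg : HasMeg (P₃ ∖ edges) 0
P₃∖edges-meg = (⊥ , fromIsMEG meg , refl) , λ _ _ → z≤n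
  where
  meg : IsMEG (P₃ ∖ edges) ⊥
  meg = record
    { monitored   = λ (a , kept) → contradiction a kept
    ; nonIsolated = ⊥-elim ∘ ∉⊥
    }

theorem4p3 : (∀ (n : ℕ) (G : Graph (Fin n)) (k l : ℕ) (es : List (Fin n × Fin n)) →
    PendantRemoval G k l es →
    ∀ (m m′ : ℕ) → HasMeg G m → HasMeg (G ∖ es) m′ →
    (m ⊖ l ≤ℤ + m′) × (m′ ≤ m))
    × (∃[ n ] Σ (Graph (Fin n)) λ G → ∃[ k ] ∃[ l ] ∃[ es ] ∃[ m ] ∃[ m′ ]
    (PendantRemoval G k l es × 1 ≤ l × HasMeg G m × HasMeg (G ∖ es) m′
    × m ⊖ l ≡ + m′))
    × (∃[ n ] Σ (Graph (Fin n)) λ G → ∃[ k ] ∃[ l ] ∃[ es ] ∃[ m ] ∃[ m′ ]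
    (PendantRemoval G k l es × 1 ≤ l × HasMeg G m × HasMeg (G ∖ es) m′
    × m′ ≡ m))
theorem4p3 =
  (λ n G k l es removal m m′ → pendantRemoval-bounds {G = G} removal) ,
  -- Removing both edges lowers meg from 2 to 0; removing one leaves it at 2. Both have `1 ≤ l`, so
  -- neither equality is the trivial one of removing nothing.
  (3 , P₃ , 2 , 2 , edges , 2 , 0 , removeBoth , s≤s z≤n , P₃-meg , P₃∖edges-meg , refl) ,
  (3 , P₃ , 2 , 1 , e₀ ∷ [] , 2 , 2 , removeOne , s≤s z≤n , P₃-meg , P₃∖e₀-meg , refl)
  where
  removeBoth : PendantRemoval P₃ 2 2 edges
  removeBoth = record
    { connected  = P₃-connected
    ; numPendant = P₃-numPendant
    ; l≤k        = ≤-refl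
    ; distinct   = P₃-distinct
    ; pendant    = P₃-pendant
    ; size       = refl
    }
  removeOne : PendantRemoval P₃ 2 1 (e₀ ∷ [])
  removeOne = record
    { connected  = P₃-connected
    ; numPendant = P₃-numPendant
    ; l≤k        = s≤s z≤n
    ; distinct   = [] ∷ []
    ; pendant    = All.head P₃-pendant ∷ []
    ; size       = refl
    }
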